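{- Let $\lambda$ be a partition with $n$ parts and let $\beta$ be an upper $\lambda$-tuple, i.e. $\beta \in U_\lambda(n)$. Then the terminal pair $(\lambda,\beta)$ is nonpermutable if and only if $\beta$ is a gapless core $\lambda$-tuple that is bounded by its platform, i.e. if and only if $\beta \in UGC_\lambda(n) \cap UBP_\lambda(n)$.
   Context: Fix an integer $n \geq 1$ and write $[k] = \{1,\dots,k\}$ and $(a,b] = \{a+1,\dots,b\}$. A partition is $\lambda = (\lambda_1,\dots,\lambda_n)$ with $\lambda_1 \geq \dots \geq \lambda_n \geq 0$ integers. Let $R_\lambda \subseteq [n-1]$ be the set of $q \in [n-1]$ with $\lambda_q > \lambda_{q+1}$ (equivalently, the set of distinct column lengths of the Young diagram of $\lambda$ that are less than $n$); write its elements $q_1 < \dots < q_r$ ($r \geq 0$), and set $q_0 := 0$, $q_{r+1} := n$. For $h \in [r+1]$ the $h$-th carrel is the index interval $(q_{h-1}, q_h]$. A $\lambda$-tuple is an $n$-tuple $\beta = (\beta_1,\dots,\beta_n)$ with entries in $[n]$, considered together with this carrel structure; it is upper if $\beta_i \geq i$ for all $i \in [n]$. $U_\lambda(n)$ denotes the set of upper $\lambda$-tuples, partially ordered entrywise. Critical indices: let $\beta \in U_\lambda(n)$ and $h \in [r+1]$. Set $x_1 := q_h$. Recursively, given $x_{u-1}$, if there is an index $x$ with $q_{h-1} < x < x_{u-1}$ and $\beta_{x_{u-1}} - \beta_x > x_{u-1} - x$, let $x_u$ be the largest such $x$; otherwise stop. The indices $x_1 > x_2 > \cdots$ so obtained are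 the critical indices of $\beta$ in the $h$-th carrel; the pairs $(x_u, \beta_{x_u})$ are its critical pairs, and the sequence over $h$ of the sets of critical pairs is the critical list of $\beta$. For $i \in [n]$ let $x(i)$ be the smallest critical index of $\beta$ lying in the carrel containing $i$ with $x(i) \geq i$. The $\lambda$-platform of $\beta$ is $\Xi_\lambda(\beta) := \xi$ with $\xi_i := \beta_{x(i)}$ for $i \in [n]$. The critical list of $\beta$ is a flag critical list if for every $h \in [r]$ one has $\beta_{q_h} \leq \beta_k$, where $k$ is the smallest critical index of $\beta$ in the $(h+1)$-st carrel. $UGC_\lambda(n)$ (gapless core $\lambda$-tuples) is the set of $\beta \in U_\lambda(n)$ whose critical list is a flag critical list. $UBP_\lambda(n)$ (tuples bounded by their platform) is the set of $\beta \in U_\lambda(n)$ with $\beta_i \leq \Xi_\lambda(\beta)_i$ for all $i$. Lattice paths: lattice points are pairs $(a,b)$ of integers with $a \geq 0$, $b \geq 1$ (think of $a$ as the eastward coordinate and $b$ as the southward depth). A lattice path is a sequence of lattice points in which each consecutive step is either an easterly step $(a,b) \to (a+1,b)$ or a southerly step $(a,b) \to (a,b+1)$. An $n$-path is an $n$-tuple $(\Lambda_1,\dots,\Lambda_n)$ of lattice paths such that $\Lambda_m$ starts at $(n-m, m)$ for $m \in [n]$. Given $\beta \in U_\lambda(n)$, the terminals are the points $P_m := (\lambda_m + n - m, \beta_m)$, $m \in [n]$. For a permutation $\pi$ of $[n]$, let $\mathcal{LD}_\lambda(\beta;\pi)$ be the set of $n$-paths in which $\Lambda_m$ ends at $P_{\pi_m}$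 for each $m$ and no two distinct components share a lattice point. The terminal pair $(\lambda,\beta)$ is nonpermutable if $\mathcal{LD}_\lambda(\beta;\pi) = \emptyset$ for every permutation $\pi \neq (1,2,\dots,n)$. -}

module Defs where

open import Data.Fin.Base as Fin using (Fin; toℕ; fromℕ<)
import Data.Fin.Properties as Fin
open import Data.Fin.Induction using (<-wellFounded; >-wellFounded)
open import Data.Fin.Permutation using (Permutation′; _⟨$⟩ʳ_; _≈_; id)
open import Data.Nat.Base using (ℕ; zero; suc; _+_; _∸_; _≤_; _<_; _>_; z≤n; s≤s; z<s)
open import Data.Nat.Properties
open import Data.Product.Base using (Σ; ∃; ∃-syntax; _×_; _,_; proj₁; proj₂)
open import Data.Sum.Base using (_⊎_; inj₁; inj₂)
open import Induction.WellFounded using (Acc; acc)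
open import Relation.Binary.Construct.Closure.ReflexiveTransitive using (Star; ε; _◅_)
open import Relation.Binary.PropositionalEquality using (_≡_; _≢_; refl; sym; trans; cong; subst)
open import Relation.Nullary using (¬_; Dec; yes; no; contradiction)
open import Relation.Nullary.Decidable using (_×-dec_; _⊎-dec_; _→-dec_; map′)

-- The set [n] = {1,…,n} is represented by Fin n; the element represented by
-- i : Fin n is the number label i.
label : ∀ {n} → Fin n → ℕ
label i = suc (toℕ i)

record Partition (n : ℕ) : Set where
  field
    part       : Fin n → ℕ
    decreasing : ∀ i j → i Fin.≤ j → part j ≤ part i

open Partition public

Tuple : ℕ → Set
Tuple n = Fin n → Fin n

infixl 9 _at_

_at_ : ∀ {n} → Tuple n → Fin n → ℕ
β at i = label (β i)

Upper : ∀ {n} → Tuple n → Set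
Upper {n} β = ∀ i → label i ≤ β at i

-- q ∈ R_λ; the two indices force q ∈ [n-1].
InR : ∀ {n} → Partition n → ℕ → Set
InR {n} lam q =
  ∃[ i ] ∃[ j ] (label {n} i ≡ q × label {n} j ≡ suc q × part lam i > part lam j)

-- q ∈ {q_0,…,q_{r+1}} = {0} ∪ R_λ ∪ {n}
Cut : ∀ {n} → Partition n → ℕ → Set
Cut {n} lam q = q ≡ 0 ⊎ InR lam q ⊎ q ≡ n

-- A carrel (q_{h-1}, q_h] is given by its end points, which are consecutive
-- elements of {0} ∪ R_λ ∪ {n}.  The carrel following C is the one whose left
-- end point is right C.
record Carrel {n : ℕ} (lam : Partition n) : Set where
  field
    left right  : ℕ
    left<right  : left < right
    cut-left    : Cut lam left
    cut-right   : Cut lam right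
    consecutive : ∀ q → left < q → q < right → ¬ Cut lam q

open Carrel public

infix 4 _∈ᶜ_

_∈ᶜ_ : ∀ {n} {lam : Partition n} → Fin n → Carrel lam → Set
i ∈ᶜ C = left C < label i × label i ≤ right C

module _ {n : ℕ} {lam : Partition n} (β : Tuple n) (C : Carrel lam) where

  -- q_{h-1} < y < x and β_x - β_y > x - y, the latter written additively since
  -- subtraction on ℕ is truncated.
  Drop : Fin n → Fin n → Set
  Drop x y =
    left C < label y × label y < label x × β at x + label y > label x + β at y

  Next : Fin n → Fin n → Set
  Next x y = Drop x y × (∀ z → Drop x z → label z ≤ label y)

  data Critical : Fin n → Set where
    first : ∀ {x} → label x ≡ right C → Critical x
    next  : ∀ {x y} → Critical x → Next x y → Critical y

  SmallestCritical : Fin n → Set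
  SmallestCritical k = Critical k × (∀ y → Critical y → label k ≤ label y)

  SmallestCriticalFrom : Fin n → Fin n → Set
  SmallestCriticalFrom i x =
    Critical x × label i ≤ label x ×
    (∀ y → Critical y → label i ≤ label y → label x ≤ label y)

------------------------------------------------------------------------
-- Existence of the carrel containing i and of x(i), needed to define the
-- platform as a function, and of the smallest critical index of a carrel.

InR? : ∀ {n} (lam : Partition n) q → Dec (InR lam q)
InR? lam q = Fin.any? λ i → Fin.any? λ j →
  (label i ≟ q) ×-dec (label j ≟ suc q) ×-dec (part lam j <? part lam i)

Cut? : ∀ {n} (lam : Partition n) q → Dec (Cut lam q)
Cut? {n} lam q = (q ≟ 0) ⊎-dec (InR? lam q ⊎-dec (q ≟ n))

Cut⇒≤n : ∀ {n} (lam : Partition n) {q} → Cut lam q → q ≤ n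
Cut⇒≤n lam (inj₁ refl)                          = z≤n
Cut⇒≤n lam (inj₂ (inj₁ (i , _ , refl , _)))     = Fin.toℕ<n i
Cut⇒≤n lam (inj₂ (inj₂ refl))                   = ≤-refl

private
  cutBelow : ∀ {n} (lam : Partition n) k →
    ∃[ a ] (a ≤ k × Cut lam a × (∀ q → a < q → q ≤ k → ¬ Cut lam q))
  cutBelow lam zero =
    0 , z≤n , inj₁ refl , λ q 0<q q≤0 _ → contradiction q≤0 (<⇒≱ 0<q)
  cutBelow lam (suc k) with Cut? lam (suc k)
  ... | yes c = suc k , ≤-refl , c , λ q k<q q≤k _ → contradiction q≤k (<⇒≱ k<q)
  ... | no ¬c with cutBelow lam k
  ...   | a , a≤k , ca , none = a , m≤n⇒m≤1+n a≤k , ca , none′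
    where
    none′ : ∀ q → a < q → q ≤ suc k → ¬ Cut lam q
    none′ q a<q q≤ cq with m≤n⇒m<n∨m≡n q≤
    ... | inj₁ (s≤s q≤k) = none q a<q q≤k cq
    ... | inj₂ refl      = ¬c cq

  cutAbove : ∀ {n} (lam : Partition n) d k → k + d ≡ n →
    ∃[ b ] (k ≤ b × Cut lam b × (∀ q → k ≤ q → q < b → ¬ Cut lam q))
  cutAbove lam zero k eq =
    k , ≤-refl , inj₂ (inj₂ (trans (sym (+-identityʳ k)) eq)) ,
    λ q k≤q q<k _ → <⇒≱ q<k k≤q
  cutAbove lam (suc d) k eq with Cut? lam k
  ... | yes c = k , ≤-refl , c , λ q k≤q q<k _ → <⇒≱ q<k k≤q
  ... | no ¬c with cutAbove lam d (suc k) (trans (sym (+-suc k d)) eq)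
  ...   | b , k<b , cb , none = b , <⇒≤ k<b , cb , none′
    where
    none′ : ∀ q → k ≤ q → q < b → ¬ Cut lam q
    none′ q k≤q q<b cq with m≤n⇒m<n∨m≡n k≤q
    ... | inj₁ k<q  = none q k<q q<b cq
    ... | inj₂ refl = ¬c cq

carrel-of : ∀ {n} (lam : Partition n) (i : Fin n) → Σ (Carrel lam) (i ∈ᶜ_)
carrel-of {n} lam i
  with cutBelow lam (toℕ i) | cutAbove lam (n ∸ label i) (label i) (m+[n∸m]≡n (Fin.toℕ<n i))
... | a , a≤i , ca , noneₗ | b , i<b , cb , noneᵣ = C , s≤s a≤i , i<b
  where
  none : ∀ q → a < q → q < b → ¬ Cut lam q
  none q a<q q<b with q ≤? toℕ i
  ... | yes q≤i = noneₗ q a<q q≤i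
  ... | no  q≰i = noneᵣ q (≰⇒> q≰i) q<b
  C : Carrel lam
  C = record { left = a ; right = b ; left<right = ≤-<-trans a≤i i<b
             ; cut-left = ca ; cut-right = cb ; consecutive = none }

module _ {n : ℕ} {lam : Partition n} (β : Tuple n) (C : Carrel lam) where

  Drop? : ∀ x y → Dec (Drop β C x y)
  Drop? x y = (left C <? label y) ×-dec (label y <? label x) ×-dec
              (label x + β at y <? β at x + label y)

  Next? : ∀ x y → Dec (Next β C x y)
  Next? x y = Drop? x y ×-dec
              Fin.all? (λ z → Drop? x z →-dec (label z ≤? label y))

  Critical? : ∀ y → Dec (Critical β C y)
  Critical? y = go y (>-wellFounded y)
    where
    go : ∀ y → Acc Fin._>_ y → Dec (Critical β C y)
    go y (acc rs) = map′ to from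
      ((label y ≟ right C) ⊎-dec Fin.any? viaNext?)
      where
      ViaNext : Fin n → Set
      ViaNext x = Critical β C x × Next β C x y

      viaNext? : ∀ x → Dec (ViaNext x)
      viaNext? x with Next? x y
      ... | no ¬p = no λ (_ , p) → ¬p p
      ... | yes p@((_ , s≤s y<x , _) , _) =
        map′ (λ c → c , p) proj₁ (go x (rs y<x))

      to : (label y ≡ right C ⊎ ∃ ViaNext) → Critical β C y
      to (inj₁ eq)          = first eq
      to (inj₂ (_ , c , p)) = next c p

      from : Critical β C y → (label y ≡ right C ⊎ ∃ ViaNext)
      from (first eq)   = inj₁ eq
      from (next c p)   = inj₂ (_ , c , p)

  last : ∃[ x ] (label x ≡ right C)
  last = go (right C) (<-≤-trans z<s (left<right C)) (Cut⇒≤n lam (cut-right C))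
    where
    go : ∀ b → 0 < b → b ≤ n → ∃[ x ] (label {n} x ≡ b)
    go (suc b) _ b<n = fromℕ< b<n , cong suc (Fin.toℕ-fromℕ< b<n)

  private
    smallest≥ : ∀ k → k ≤ right C →
      ∃[ x ] (Critical β C x × k ≤ label x ×
              (∀ y → Critical β C y → k ≤ label y → label x ≤ label y))
    smallest≥ k k≤r = descend (proj₁ last) (<-wellFounded (proj₁ last)) (first (proj₂ last))
        (subst (k ≤_) (sym (proj₂ last)) k≤r)
      where
      descend : ∀ x → Acc Fin._<_ x → Critical β C x → k ≤ label x →
        ∃[ x ] (Critical β C x × k ≤ label x ×
                (∀ y → Critical β C y → k ≤ label y → label x ≤ label y))
      descend x (acc rs) cx k≤x
        with Fin.any? (λ y → Critical? y ×-dec (k ≤? label y) ×-dec (label y <? label x))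
      ... | yes (y , cy , k≤y , s≤s y<x) = descend y (rs y<x) cy k≤y
      ... | no ¬smaller = x , cx , k≤x ,
              λ y cy k≤y → ≮⇒≥ (λ y<x → ¬smaller (y , cy , k≤y , y<x))

  smallest-critical : ∃ (SmallestCritical β C)
  smallest-critical with smallest≥ 0 z≤n
  ... | x , cx , _ , least = x , cx , λ y cy → least y cy z≤n

  smallest-critical-from : ∀ i → i ∈ᶜ C → ∃ (SmallestCriticalFrom β C i)
  smallest-critical-from i (_ , i≤r) = smallest≥ (label i) i≤r

------------------------------------------------------------------------

platform-index : ∀ {n} → Partition n → Tuple n → Fin n → Fin n
platform-index lam β i =
  let (C , i∈C) = carrel-of lam i in proj₁ (smallest-critical-from β C i i∈C)

-- Ξ_λ(β)
platform : ∀ {n} → Partition n → Tuple n → Tuple n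
platform lam β i = β (platform-index lam β i)

-- C and D range over the h-th and (h+1)-st carrels, h ∈ [r], and x is q_h.
FlagCriticalList : ∀ {n} → Partition n → Tuple n → Set
FlagCriticalList lam β =
  ∀ (C D : Carrel lam) → right C ≡ left D →
  ∀ x k → label x ≡ right C → SmallestCritical β D k → β at x ≤ β at k

UGC : ∀ {n} → Partition n → Tuple n → Set
UGC lam β = Upper β × FlagCriticalList lam β

UBP : ∀ {n} → Partition n → Tuple n → Set
UBP lam β = Upper β × (∀ i → β at i ≤ platform lam β at i)

------------------------------------------------------------------------

-- (a , b): eastward coordinate a, southward depth b.  The bound b ≥ 1 is not
-- imposed: the paths below start at depth ≥ 1 and depth never decreases.
Point : Set
Point = ℕ × ℕ

data Step : Point → Point → Set where
  easterly  : ∀ {a b} → Step (a , b) (suc a , b)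
  southerly : ∀ {a b} → Step (a , b) (a , suc b)

Path : Point → Point → Set
Path = Star Step

infix 4 _∈ᵖ_

data _∈ᵖ_ (p : Point) : ∀ {s t} → Path s t → Set where
  here  : ∀ {t} {π : Path p t} → p ∈ᵖ π
  there : ∀ {s u t} {e : Step s u} {π : Path u t} → p ∈ᵖ π → p ∈ᵖ (e ◅ π)

source : ∀ {n} → Fin n → Point
source {n} m = (n ∸ label m , label m)

terminal : ∀ {n} → Partition n → Tuple n → Fin n → Point
terminal {n} lam β m = (part lam m + (n ∸ label m) , β at m)

LD : ∀ {n} → Partition n → Tuple n → Permutation′ n → Set
LD {n} lam β π =
  Σ (∀ m → Path (source m) (terminal lam β (π ⟨$⟩ʳ m))) λ Λ →
    ∀ l m → l ≢ m → ∀ p → ¬ (p ∈ᵖ Λ l × p ∈ᵖ Λ m)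

Nonpermutable : ∀ {n} → Partition n → Tuple n → Set
Nonpermutable {n} lam β = ∀ (π : Permutation′ n) → ¬ (π ≈ id) → ¬ LD lam β π

{-# OPTIONS --safe #-}
module Submission where

-- Both conditions say that every critical index t dominates the earlier ones: β_j ≤ β_t for j ≤ t.
-- If some β_j > β_t, let i be the last index before t with β_i > β_t.  The cycle t ↦ i, m ↦ m + 1 for
-- i ≤ m < t is realised by disjoint staircases: the path from source t passes just below the terminals
-- i + 1, …, t, and the paths to the later terminals of the carrel, which are deep enough because t is
-- critical, make way for it.
-- Conversely let t be the first critical index from i on.  Terminals i, …, t occupy consecutive columns,
-- lie no deeper than terminal t and on or beyond its antidiagonal, so the paths to them fill the part of
-- this antidiagonal between their columns.  A path from a source beyond that of terminal i to a terminal
-- j < i would have to cross the same part.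

open import Defs
open import Data.Fin.Base as Fin using (Fin; zero; suc; toℕ; fromℕ<; punchIn; punchOut)
import Data.Fin.Properties as Fin
open import Data.Fin.Induction using (<-wellFounded; >-wellFounded)
open import Data.Fin.Permutation using (Permutation′; _⟨$⟩ʳ_; _⟨$⟩ˡ_; _≈_; id; insert; insert-punchIn; inverseʳ; inverseˡ)
open import Data.Nat.Base
open import Data.Nat.Properties
open import Data.Nat.Tactic.RingSolver using (solve-∀)
open import Data.Product.Base using (∃; ∃-syntax; _×_; _,_; proj₁; proj₂)
open import Data.Sum.Base using (_⊎_; inj₁; inj₂)
open import Function.Base using (case_of_; _∘_)
open import Function.Bundles using (_⇔_; mk⇔)
open import Induction.WellFounded using (Acc; acc)
open import Relation.Binary.Construct.Closure.ReflexiveTransitive using (ε; _◅_; _◅◅_)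
open import Relation.Binary.Definitions using (tri<; tri≈; tri>)
open import Relation.Binary.PropositionalEquality
open import Relation.Nullary using (¬_; yes; no; contradiction)
open import Relation.Nullary.Decidable using (_×-dec_)
open import Relation.Unary using (Decidable)

-- Transitivity of `a - a′ < b - b′ ≤ c - c′`, written additively since subtraction on ℕ truncates.
slope-trans : ∀ a a′ b b′ c c′ → a + b′ < a′ + b → b + c′ ≤ b′ + c → a + c′ < a′ + c
slope-trans a a′ b b′ c c′ p q =
  +-cancelʳ-< (b + b′) _ _ (subst₂ _<_ (lhs a b b′ c′) (rhs a′ b b′ c) (+-mono-<-≤ p q))
  where
  lhs : ∀ a b b′ c′ → a + b′ + (b + c′) ≡ a + c′ + (b + b′)
  lhs = solve-∀
  rhs : ∀ a′ b b′ c → a′ + b + (b′ + c) ≡ a′ + c + (b + b′)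
  rhs = solve-∀

largest : ∀ {n} {P : Fin n → Set} → Decidable P → ∃ P →
  ∃[ x ] (P x × (∀ z → P z → z Fin.≤ x))
largest {P = P} P? (x , px) = ascend x (>-wellFounded x) px
  where
  ascend : ∀ x → Acc Fin._>_ x → P x → ∃[ x ] (P x × (∀ z → P z → z Fin.≤ x))
  ascend x (acc rs) px with Fin.any? (λ z → P? z ×-dec (x Fin.<? z))
  ... | yes (z , pz , x<z) = ascend z (rs x<z) pz
  ... | no ¬larger         = x , px , λ z pz → ≮⇒≥ (λ x<z → ¬larger (z , pz , x<z))

-- Critical indices

module _ {n : ℕ} {lam : Partition n} (β : Tuple n) (C : Carrel lam) where

  critical-∈ : ∀ {t} → Critical β C t → t ∈ᶜ C
  critical-∈ (first eq) = subst (left C <_) (sym eq) (left<right C) , ≤-reflexive eq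
  critical-∈ (next cx ((l<y , y<x , _) , _)) = l<y , ≤-trans (<⇒≤ y<x) (proj₂ (critical-∈ cx))

  -- By induction along the critical list, with x the critical index from which t is reached. Beyond
  -- x, the induction hypothesis for x is chained with the drop from x to t. Between t and x,
  -- maximality of t rules out a drop from x to y, which supplies the other half of the chain.
  critical-steep : ∀ {t} → Critical β C t → ∀ y → label t < label y → label y ≤ right C →
    label y + β at t < β at y + label t
  critical-steep (first eq) y t<y y≤r = contradiction y≤r (<⇒≱ (subst (_< label y) eq t<y))
  critical-steep {t} (next {x} cx ((l<t , t<x , steep) , greatest)) y t<y y≤r
    with Fin.<-cmp y x
  ... | tri≈ _ refl _ = steep
  ... | tri> _ _ x<y  = slope-trans (label y) (β at y) (label x) (β at x) (label t) (β at t)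
    (critical-steep cx y (s≤s x<y) y≤r) (<⇒≤ steep)
  ... | tri< y<x _ _  = subst₂ _<_ (+-comm (β at t) (label y)) (+-comm (label t) (β at y))
    (slope-trans (β at t) (label t) (β at x) (label x) (β at y) (label y)
      (subst₂ _<_ (+-comm (label x) (β at t)) (+-comm (β at x) (label t)) steep) gentle)
    where
    gentle : β at x + label y ≤ label x + β at y
    gentle = ≮⇒≥ λ p → <⇒≱ t<y (greatest y (≤-<-trans (<⇒≤ l<t) t<y , s≤s y<x , p))

  critical-mono : ∀ {s t} → Critical β C s → Critical β C t → label s ≤ label t →
    β at s ≤ β at t
  critical-mono {s} {t} cs ct s≤t with m≤n⇒m<n∨m≡n s≤t
  ... | inj₂ eq  = ≤-reflexive (cong (β at_) (Fin.toℕ-injective (suc-injective eq)))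
  ... | inj₁ s<t = <⇒≤ (+-cancelˡ-< (label s) _ _ (begin-strict
    label s + β at s  <⟨ +-monoˡ-< (β at s) s<t ⟩
    label t + β at s  <⟨ critical-steep cs t s<t (proj₂ (critical-∈ ct)) ⟩
    β at t + label s  ≡⟨ +-comm (β at t) (label s) ⟩
    label s + β at t  ∎))
    where open ≤-Reasoning

  -- The largest index admitting a drop from t would be the next critical index, still at or after
  -- i, against the choice of t.
  smallest-no-drop : ∀ {i t} → SmallestCriticalFrom β C i t →
    ∀ y → label i ≤ label y → ¬ Drop β C t y
  smallest-no-drop {t = t} (ct , i≤t , least) y i≤y drop
    with largest (Drop? β C t) (y , drop)
  ... | z , dz@(_ , z<t , _) , greatest =
    <⇒≱ z<t (least z (next ct (dz , λ w dw → s≤s (greatest w dw)))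
                     (≤-trans i≤y (s≤s (greatest y drop))))

  -- Serves to place the terminals i, ..., t on or beyond the antidiagonal of terminal t, since
  -- columns in a carrel descend by one per index.
  smallest-gentle : ∀ {i t} → i ∈ᶜ C → SmallestCriticalFrom β C i t →
    ∀ y → label i ≤ label y → label y ≤ label t → β at t + label y ≤ label t + β at y
  smallest-gentle {t = t} (l<i , _) sm y i≤y y≤t with m≤n⇒m<n∨m≡n y≤t
  ... | inj₁ y<t = ≮⇒≥ λ p → smallest-no-drop sm y i≤y (<-≤-trans l<i i≤y , y<t , p)
  ... | inj₂ eq rewrite Fin.toℕ-injective (suc-injective eq) =
    ≤-reflexive (+-comm (β at t) (label t))

-- Carrels with a common index

module _ {n : ℕ} {lam : Partition n} where

  -- Otherwise the cut `left C` would lie strictly inside `D`.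
  left-≤ : (C D : Carrel lam) → ∀ {i} → i ∈ᶜ C → i ∈ᶜ D → left C ≤ left D
  left-≤ C D (lC<i , _) (_ , i≤rD) = ≮⇒≥ λ lD<lC →
    consecutive D (left C) lD<lC (<-≤-trans lC<i i≤rD) (cut-left C)

  right-≤ : (C D : Carrel lam) → ∀ {i} → i ∈ᶜ C → i ∈ᶜ D → right C ≤ right D
  right-≤ C D (lC<i , _) (_ , i≤rD) = ≮⇒≥ λ rD<rC →
    consecutive C (right D) (<-≤-trans lC<i i≤rD) rD<rC (cut-right D)

  -- Two `Carrel` records with the same end points may differ in their proof fields, so criticality
  -- is transported along the end points alone.
  critical-resp : ∀ {β} (C D : Carrel lam) → left C ≡ left D → right C ≡ right D →
    ∀ {t} → Critical β C t → Critical β D t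
  critical-resp C D l≡ r≡ (first eq) = first (trans eq r≡)
  critical-resp C D l≡ r≡ (next cx ((l<y , rest) , greatest)) =
    next (critical-resp C D l≡ r≡ cx)
      ((subst (_< _) l≡ l<y , rest) ,
       λ z (l<z , rest′) → greatest z (subst (_< _) (sym l≡) l<z , rest′))

  critical-same-carrel : ∀ {β} (C D : Carrel lam) → ∀ {i} → i ∈ᶜ C → i ∈ᶜ D →
    ∀ {t} → Critical β C t → Critical β D t
  critical-same-carrel C D i∈C i∈D = critical-resp C D
    (≤-antisym (left-≤ C D i∈C i∈D) (left-≤ D C i∈D i∈C))
    (≤-antisym (right-≤ C D i∈C i∈D) (right-≤ D C i∈D i∈C))

  -- A descent of λ between two neighbouring indices would be a cut inside the carrel.
  part-constant : (C : Carrel lam) → ∀ {i t} → left C < label i → label t ≤ right C →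
    i Fin.≤ t → part lam t ≡ part lam i
  part-constant C {i} {t} l<i t≤r i≤t =
    ≤-antisym (decreasing lam i t i≤t) (go (toℕ t ∸ toℕ i) i l<i (m∸n+n≡m i≤t))
    where
    go : ∀ k i → left C < label i → k + toℕ i ≡ toℕ t → part lam i ≤ part lam t
    go zero    i l<i eq = ≤-reflexive (cong (part lam) (Fin.toℕ-injective eq))
    go (suc k) i l<i eq = ≤-trans (≮⇒≥ no-descent)
      (go k i′ (subst (λ x → left C < suc x) (sym i′≡) (m<n⇒m<1+n l<i))
              (trans (cong (k +_) i′≡) (trans (+-suc k (toℕ i)) eq)))
      where
      i<t : toℕ i < toℕ t
      i<t = ≤-trans (s≤s (m≤n+m (toℕ i) k)) (≤-reflexive eq)
      i<n : suc (toℕ i) < n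
      i<n = ≤-<-trans i<t (Fin.toℕ<n t)
      i′ : Fin n
      i′ = fromℕ< i<n
      i′≡ : toℕ i′ ≡ suc (toℕ i)
      i′≡ = Fin.toℕ-fromℕ< i<n
      no-descent : ¬ (part lam i′ < part lam i)
      no-descent p = consecutive C (label i) l<i (<-≤-trans (s≤s i<t) t≤r)
        (inj₂ (inj₁ (i , i′ , refl , cong suc i′≡ , p)))

-- Domination by critical indices

-- The index j ranges over earlier carrels as well: inside the carrel of t this amounts to
-- boundedness by the platform, across carrels it carries the flag condition.
CriticalDominates : ∀ {n} → Partition n → Tuple n → Set
CriticalDominates lam β =
  ∀ (C : Carrel lam) t → Critical β C t → ∀ j → j Fin.≤ t → β at j ≤ β at t

platform-spec : ∀ {n} (lam : Partition n) (β : Tuple n) i →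
  ∃[ C ] ∃[ t ] (i ∈ᶜ C × SmallestCriticalFrom {lam = lam} β C i t × platform lam β i ≡ β t)
platform-spec lam β i =
  proj₁ (carrel-of lam i) , platform-index lam β i , proj₂ (carrel-of lam i) ,
  proj₂ (smallest-critical-from β (proj₁ (carrel-of lam i)) i (proj₂ (carrel-of lam i))) , refl

module _ {n : ℕ} {lam : Partition n} {β : Tuple n} where

  -- Both conditions are instances: q_h against the smallest critical index of the next carrel, and
  -- i against x(i).
  dominates⇒UGC∩UBP : Upper β → CriticalDominates lam β → UGC lam β × UBP lam β
  dominates⇒UGC∩UBP upper dom = (upper , flag) , (upper , bounded)
    where
    flag : FlagCriticalList lam β
    flag C D rC≡lD x k x≡rC (ck , _) = dom D k ck x
      (s≤s⁻¹ (<⇒≤ (subst (_< label k) (sym (trans x≡rC rC≡lD)) (proj₁ (critical-∈ β D ck)))))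
    bounded : ∀ i → β at i ≤ platform lam β at i
    bounded i = case platform-spec lam β i of λ where
      (C , t , _ , (ct , i≤t , _) , eq) →
        subst (λ v → β at i ≤ label v) (sym eq) (dom C t ct i (s≤s⁻¹ i≤t))

  -- The platform at j is β at the first critical index from j on; that index is at most t, and β
  -- increases along critical indices.
  bounded⇒dominates-in-carrel : (∀ i → β at i ≤ platform lam β at i) →
    ∀ (C : Carrel lam) t → Critical β C t → ∀ j → left C < label j → j Fin.≤ t → β at j ≤ β at t
  bounded⇒dominates-in-carrel bounded C t ct j l<j j≤t = case platform-spec lam β j of λ where
    (D , s , j∈D , (cs , _ , least) , eq) →
      let ct′ = critical-same-carrel C D
                  (l<j , ≤-trans (s≤s j≤t) (proj₂ (critical-∈ β C ct))) j∈D ct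
      in ≤-trans (subst (λ v → β at j ≤ label v) eq (bounded j))
                 (critical-mono β D cs ct′ (least t ct′ (s≤s j≤t)))

  -- Induction on t. An index j outside the carrel lies before it, and β_j ≤ β_q ≤ β_k ≤ β_t, where
  -- q ends the preceding carrel and k is the smallest critical index of `C`.
  flag⇒dominates : FlagCriticalList lam β →
    (∀ (C : Carrel lam) t → Critical β C t → ∀ j → left C < label j → j Fin.≤ t → β at j ≤ β at t) →
    CriticalDominates lam β
  flag⇒dominates flag same C t ct = go C t (<-wellFounded t) ct
    where
    go : ∀ (C : Carrel lam) t → Acc Fin._<_ t → Critical β C t → ∀ j → j Fin.≤ t → β at j ≤ β at t
    go C t (acc rs) ct j j≤t with left C <? label j
    ... | yes l<j = same C t ct j l<j j≤t
    ... | no  l≮j = ≤-trans (go B q (rs q<t) (first (sym rB≡q)) j (s≤s⁻¹ (subst (label j ≤_) (sym q≡) j≤l)))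
                     (≤-trans (flag B C (trans rB≡q q≡) q k (sym rB≡q) sk)
                              (critical-mono β C (proj₁ sk) ct (proj₂ sk t ct)))
      where
      j≤l : label j ≤ left C
      j≤l = ≮⇒≥ l≮j
      lC≤n : pred (left C) < n
      lC≤n = subst (_≤ n) (sym (suc-pred (left C) ⦃ >-nonZero (<-≤-trans z<s j≤l) ⦄)) (Cut⇒≤n lam (cut-left C))
      q : Fin n
      q = fromℕ< lC≤n
      q≡ : label q ≡ left C
      q≡ = trans (cong suc (Fin.toℕ-fromℕ< lC≤n)) (suc-pred (left C) ⦃ >-nonZero (<-≤-trans z<s j≤l) ⦄)
      B : Carrel lam
      B = proj₁ (carrel-of lam q)
      q∈B : q ∈ᶜ B
      q∈B = proj₂ (carrel-of lam q)
      rB≡q : right B ≡ label q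
      rB≡q = ≤-antisym (≮⇒≥ λ q<rB → consecutive B (label q) (proj₁ q∈B) q<rB (subst (Cut lam) (sym q≡) (cut-left C))) (proj₂ q∈B)
      q<t : q Fin.< t
      q<t = s<s⁻¹ (subst (_< label t) (sym q≡) (proj₁ (critical-∈ β C ct)))
      k : Fin n
      k = proj₁ (smallest-critical β C)
      sk : SmallestCritical β C k
      sk = proj₂ (smallest-critical β C)

  UGC∩UBP⇒dominates : UGC lam β → UBP lam β → CriticalDominates lam β
  UGC∩UBP⇒dominates (_ , flag) (_ , bounded) =
    flag⇒dominates flag (bounded⇒dominates-in-carrel bounded)

-- Columns of the terminals and the antidiagonal of the sources

column : ∀ {n} → Partition n → Fin n → ℕ
column {n} lam m = part lam m + (n ∸ label m)

module _ {n : ℕ} (lam : Partition n) where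

  column+label : ∀ m → column lam m + label m ≡ part lam m + n
  column+label m = trans (+-assoc (part lam m) (n ∸ label m) (label m))
                         (cong (part lam m +_) (m∸n+n≡m (Fin.toℕ<n m)))

  column-anti : ∀ {l m} → l Fin.< m → column lam m < column lam l
  column-anti {l} {m} l<m =
    +-mono-≤-< (decreasing lam l m (<⇒≤ l<m)) (∸-monoʳ-< (s≤s l<m) (Fin.toℕ<n m))

  column-anti-≤ : ∀ {l m} → l Fin.≤ m → column lam m ≤ column lam l
  column-anti-≤ {l} {m} l≤m =
    +-mono-≤ (decreasing lam l m l≤m) (∸-monoʳ-≤ n (s≤s l≤m))

-- All sources share one antidiagonal, so any two paths can be followed in step.
source-sum : ∀ {n} (m : Fin n) → n ∸ label m + label m ≡ n
source-sum m = m∸n+n≡m (Fin.toℕ<n m)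

-- Paths

path-≤ : ∀ {s t} → Path s t → proj₁ s ≤ proj₁ t × proj₂ s ≤ proj₂ t
path-≤ ε               = ≤-refl , ≤-refl
path-≤ (easterly ◅ π)  = let (p , q) = path-≤ π in <⇒≤ p , q
path-≤ (southerly ◅ π) = let (p , q) = path-≤ π in p , <⇒≤ q

∈⇒≤end : ∀ {p s t} {π : Path s t} → p ∈ᵖ π → proj₁ p ≤ proj₁ t × proj₂ p ≤ proj₂ t
∈⇒≤end {π = π} here      = path-≤ π
∈⇒≤end         (there i) = ∈⇒≤end i

-- The coordinate sum grows by exactly one per step and so takes every intermediate value.
crosses : ∀ {a b p q} (π : Path (a , b) (p , q)) d → a + b ≤ d → d ≤ p + q →
  ∃[ x ] ∃[ y ] ((x , y) ∈ᵖ π × x + y ≡ d)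
crosses {a} {b} π d lo hi with m≤n⇒m<n∨m≡n lo
crosses {a} {b} π                 d lo hi | inj₂ eq = a , b , here , eq
crosses         ε                 d lo hi | inj₁ lt = contradiction hi (<⇒≱ lt)
crosses         (easterly ◅ π)    d lo hi | inj₁ lt =
  let (x , y , i , eq) = crosses π d lt hi in x , y , there i , eq
crosses {a} {b} (southerly ◅ π)   d lo hi | inj₁ lt =
  let (x , y , i , eq) = crosses π d (subst (_≤ d) (sym (+-suc a b)) lt) hi in x , y , there i , eq

Disjoint : ∀ {s t s′ t′} → Path s t → Path s′ t′ → Set
Disjoint π π′ = ∀ p → ¬ (p ∈ᵖ π × p ∈ᵖ π′)

-- Both paths advance one antidiagonal per step, so they cannot change their
-- order without meeting.
stays-west : ∀ {a b p q a′ b′ p′ q′} (π : Path (a , b) (p , q)) (π′ : Path (a′ , b′) (p′ , q′)) →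
  a + b ≡ a′ + b′ → a′ < a → p < p′ → Disjoint π π′ →
  ∀ d → a + b ≤ d → d ≤ p + q → ∃[ x ] ∃[ y ] ((x , y) ∈ᵖ π′ × x + y ≡ d × x < p)
stays-west {a} {b} {a′ = a′} {b′} π π′ eq a′<a p<p′ dj d lo hi with m≤n⇒m<n∨m≡n lo
... | inj₂ ≡d = a′ , b′ , here , trans (sym eq) ≡d , <-≤-trans a′<a (proj₁ (path-≤ π))
stays-west ε π′ eq a′<a p<p′ dj d lo hi | inj₁ lt = contradiction hi (<⇒≱ lt)
stays-west π@(_ ◅ _) ε eq a′<a p<p′ dj d lo hi | inj₁ lt =
  contradiction (<-≤-trans a′<a (proj₁ (path-≤ π))) (<⇒≯ p<p′)
stays-west (easterly ◅ π) (easterly ◅ π′) eq a′<a p<p′ dj d lo hi | inj₁ lt =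
  let (x , y , i , r) = stays-west π π′ (cong suc eq) (s<s a′<a) p<p′
                          (λ r (i , i′) → dj r (there i , there i′)) d lt hi
  in x , y , there i , r
stays-west {a} {b} {a′ = a′} {b′} (southerly ◅ π) (southerly ◅ π′) eq a′<a p<p′ dj d lo hi | inj₁ lt =
  let (x , y , i , r) = stays-west π π′ (trans (+-suc a b) (trans (cong suc eq) (sym (+-suc a′ b′))))
                          a′<a p<p′ (λ r (i , i′) → dj r (there i , there i′))
                          d (subst (_≤ d) (sym (+-suc a b)) lt) hi
  in x , y , there i , r
stays-west {a′ = a′} {b′} (easterly ◅ π) (southerly ◅ π′) eq a′<a p<p′ dj d lo hi | inj₁ lt =
  let (x , y , i , r) = stays-west π π′ (trans (cong suc eq) (sym (+-suc a′ b′))) (m<n⇒m<1+n a′<a) p<p′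
                          (λ r (i , i′) → dj r (there i , there i′)) d lt hi
  in x , y , there i , r
stays-west {a} {b} {a′ = a′} {b′} (southerly ◅ π) (easterly ◅ π′) eq a′<a p<p′ dj d lo hi | inj₁ lt
  with m≤n⇒m<n∨m≡n a′<a
... | inj₁ 1+a′<a =
  let (x , y , i , r) = stays-west π π′ (trans (+-suc a b) (cong suc eq)) 1+a′<a p<p′
                          (λ r (i , i′) → dj r (there i , there i′))
                          d (subst (_≤ d) (sym (+-suc a b)) lt) hi
  in x , y , there i , r
-- The western path was exactly one column behind, so both steps land on `(a , suc b)`.
... | inj₂ refl
  with refl ← +-cancelˡ-≡ a (suc b) b′ (trans (+-suc a b) (cong suc eq)) =
  contradiction (there here , there here) (dj (a , suc b))

-- Increasing permutations

increasing⇒inflationary : ∀ {n} (f : Fin n → Fin n) → (∀ {l m} → l Fin.< m → f l Fin.< f m) →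
  ∀ m → m Fin.≤ f m
increasing⇒inflationary {n} f mono m = go (toℕ m) m refl
  where
  go : ∀ k m → toℕ m ≡ k → m Fin.≤ f m
  go zero    m eq = subst (_≤ toℕ (f m)) (sym eq) z≤n
  go (suc k) m eq = subst (_≤ toℕ (f m)) (sym eq)
    (≤-<-trans (subst (_≤ toℕ (f l)) l≡ (go k l l≡)) (mono (subst₂ _<_ (sym l≡) (sym eq) ≤-refl)))
    where
    k<n : k < n
    k<n = <⇒≤ (subst (_< n) eq (Fin.toℕ<n m))
    l : Fin n
    l = fromℕ< k<n
    l≡ : toℕ l ≡ k
    l≡ = Fin.toℕ-fromℕ< k<n

-- The permutation and its inverse are both inflationary, which bounds each value from both sides.
increasing⇒identity : ∀ {n} (π : Permutation′ n) →
  (∀ {l m} → l Fin.< m → (π ⟨$⟩ʳ l) Fin.< (π ⟨$⟩ʳ m)) → π ≈ id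
increasing⇒identity π mono m = Fin.toℕ-injective (≤-antisym
  (subst ((π ⟨$⟩ʳ m) Fin.≤_) (inverseˡ π) (increasing⇒inflationary (π ⟨$⟩ˡ_) mono⁻¹ (π ⟨$⟩ʳ m)))
  (increasing⇒inflationary (π ⟨$⟩ʳ_) mono m))
  where
  mono⁻¹ : ∀ {l m} → l Fin.< m → (π ⟨$⟩ˡ l) Fin.< (π ⟨$⟩ˡ m)
  mono⁻¹ {l} {m} l<m with Fin.<-cmp (π ⟨$⟩ˡ l) (π ⟨$⟩ˡ m)
  ... | tri< lt _ _ = lt
  ... | tri≈ _ eq _ = contradiction (cong toℕ (trans (sym (inverseʳ π)) (trans (cong (π ⟨$⟩ʳ_) eq) (inverseʳ π)))) (<⇒≢ l<m)
  ... | tri> _ _ gt = contradiction (subst₂ Fin._<_ (inverseʳ π) (inverseʳ π) (mono gt)) (<⇒≯ l<m)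

-- Domination excludes permuted path systems

module Rigidity {n : ℕ} (lam : Partition n) (β : Tuple n) (upper : Upper β)
  (dom : CriticalDominates lam β) (π : Permutation′ n) (ld : LD lam β π) where

  X : Fin n → ℕ
  X = column lam

  -- Paths are indexed by their terminals here, since the argument follows the columns of the
  -- terminals.
  Λ : ∀ y → Path (source (π ⟨$⟩ˡ y)) (terminal lam β y)
  Λ y = subst (λ z → Path (source (π ⟨$⟩ˡ y)) (terminal lam β z)) (inverseʳ π) (proj₁ ld (π ⟨$⟩ˡ y))

  Λ-disjoint : ∀ {y z} → y ≢ z → Disjoint (Λ y) (Λ z)
  Λ-disjoint {y} {z} y≢z p (i , j) =
    proj₂ ld (π ⟨$⟩ˡ y) (π ⟨$⟩ˡ z)
      (λ eq → y≢z (trans (sym (inverseʳ π)) (trans (cong (π ⟨$⟩ʳ_) eq) (inverseʳ π))))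
      p (unsubst (inverseʳ π) i , unsubst (inverseʳ π) j)
    where
    unsubst : ∀ {s y z} (eq : y ≡ z) {Λ : Path s (terminal lam β y)} →
      p ∈ᵖ subst (λ z → Path s (terminal lam β z)) eq Λ → p ∈ᵖ Λ
    unsubst refl i = i

  module _ (C : Carrel lam) {i t : Fin n} (i∈C : i ∈ᶜ C) (sm : SmallestCriticalFrom β C i t) where

    -- The antidiagonal through terminal t.
    D : ℕ
    D = X t + β at t

    n≤D : n ≤ D
    n≤D = begin
      n                              ≡⟨ source-sum t ⟨
      n ∸ label t + label t          ≤⟨ +-mono-≤ (m≤n+m (n ∸ label t) (part lam t)) (upper t) ⟩
      X t + β at t                   ∎
      where open ≤-Reasoning

    t≤r : label t ≤ right C
    t≤r = proj₂ (critical-∈ β C (proj₁ sm))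

    i≤t : i Fin.≤ t
    i≤t = s≤s⁻¹ (proj₁ (proj₂ sm))

    -- The parts agree on a carrel, so each index moves the column west by exactly one.
    X-shift : ∀ y → i Fin.≤ y → y Fin.≤ t → X y + label y ≡ X t + label t
    X-shift y i≤y y≤t = trans (column+label lam y) (trans
      (cong (_+ n) (sym (part-constant C (<-≤-trans (proj₁ i∈C) (s≤s i≤y)) t≤r y≤t)))
      (sym (column+label lam t)))

    D≤ : ∀ y → i Fin.≤ y → y Fin.≤ t → D ≤ X y + β at y
    D≤ y i≤y y≤t = +-cancelʳ-≤ (label y + label t) _ _ (begin
      X t + β at t + (label y + label t)    ≡⟨ swap (X t) (β at t) (label y) (label t) ⟩
      X t + label t + (β at t + label y)    ≡⟨ cong (_+ (β at t + label y)) (X-shift y i≤y y≤t) ⟨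
      X y + label y + (β at t + label y)    ≤⟨ +-monoʳ-≤ (X y + label y) (smallest-gentle β C i∈C sm y (s≤s i≤y) (s≤s y≤t)) ⟩
      X y + label y + (label t + β at y)    ≡⟨ swap′ (X y) (label y) (label t) (β at y) ⟩
      X y + β at y + (label y + label t)    ∎)
      where
      open ≤-Reasoning
      swap : ∀ x b y t → x + b + (y + t) ≡ x + t + (b + y)
      swap = solve-∀
      swap′ : ∀ x y t b → x + y + (t + b) ≡ x + b + (y + t)
      swap′ = solve-∀

    X-surjective : ∀ {a y} → i Fin.≤ y → y Fin.≤ t → X t ≤ a → a ≤ X y →
      ∃[ z ] (y Fin.≤ z × z Fin.≤ t × X z ≡ a)
    X-surjective {a} {y} i≤y y≤t Xt≤a a≤Xy = z , y≤z , z≤t , +-cancelʳ-≡ (label z) (X z) a Xz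
      where
      -- Column a lies s columns east of terminal t, so it belongs to the index t - s.
      s : ℕ
      s = a ∸ X t
      s+y≤t : s + toℕ y ≤ toℕ t
      s+y≤t = s≤s⁻¹ (+-cancelˡ-≤ (X t) _ _ (begin
        X t + suc (s + toℕ y)     ≡⟨ cong (X t +_) (+-suc s (toℕ y)) ⟨
        X t + (s + label y)       ≡⟨ +-assoc (X t) s (label y) ⟨
        X t + s + label y         ≡⟨ cong (_+ label y) (m+[n∸m]≡n Xt≤a) ⟩
        a + label y               ≤⟨ +-monoˡ-≤ (label y) a≤Xy ⟩
        X y + label y             ≡⟨ X-shift y i≤y y≤t ⟩
        X t + label t             ∎))
        where open ≤-Reasoning
      z<n : toℕ t ∸ s < n
      z<n = ≤-<-trans (m∸n≤m (toℕ t) s) (Fin.toℕ<n t)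
      z : Fin n
      z = fromℕ< z<n
      z≡ : toℕ z ≡ toℕ t ∸ s
      z≡ = Fin.toℕ-fromℕ< z<n
      z≤t : z Fin.≤ t
      z≤t = subst (_≤ toℕ t) (sym z≡) (m∸n≤m (toℕ t) s)
      y≤z : y Fin.≤ z
      y≤z = subst (toℕ y ≤_) (sym z≡) (m+n≤o⇒m≤o∸n (toℕ y) (subst (_≤ toℕ t) (+-comm s (toℕ y)) s+y≤t))
      Xz : X z + label z ≡ a + label z
      Xz = begin
        X z + label z                ≡⟨ X-shift z (≤-trans i≤y y≤z) z≤t ⟩
        X t + label t                ≡⟨ cong (λ u → X t + suc u) (m+[n∸m]≡n (≤-trans (m≤m+n s (toℕ y)) s+y≤t)) ⟨
        X t + suc (s + (toℕ t ∸ s))  ≡⟨ cong (λ u → X t + suc (s + u)) z≡ ⟨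
        X t + suc (s + toℕ z)        ≡⟨ cong (X t +_) (+-suc s (toℕ z)) ⟨
        X t + (s + label z)          ≡⟨ +-assoc (X t) s (label z) ⟨
        X t + s + label z            ≡⟨ cong (_+ label z) (m+[n∸m]≡n Xt≤a) ⟩
        a + label z                  ∎
        where open ≡-Reasoning

    -- On a fixed antidiagonal, shallower means further east.
    east-of-t : ∀ {x y} → x + y ≡ D → y ≤ β at t → X t ≤ x
    east-of-t {x} {y} eq y≤ = +-cancelʳ-≤ (β at t) (X t) x
      (≤-trans (≤-reflexive (sym eq)) (+-monoʳ-≤ x y≤))

    -- On a fixed antidiagonal the column determines the point.
    same-point : ∀ {y z x x′ b b′} → y ≢ z → x ≡ x′ →
      (x , b) ∈ᵖ Λ y → x + b ≡ D → (x′ , b′) ∈ᵖ Λ z → ¬ (x′ + b′ ≡ D)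
    same-point {x = x} y≢z refl ∈Λ eq ∈Λ′ eq′
      with refl ← +-cancelˡ-≡ x _ _ (trans eq (sym eq′)) = Λ-disjoint y≢z _ (∈Λ , ∈Λ′)

    -- Downward induction from t: the path to y crosses D between the columns X t
    -- and X y, where all points but the last are taken by the paths to later terminals.
    filled : ∀ y → i Fin.≤ y → y Fin.≤ t → ∃[ b ] ((X y , b) ∈ᵖ Λ y × X y + b ≡ D)
    filled y = go y (>-wellFounded y)
      where
      go : ∀ y → Acc Fin._>_ y → i Fin.≤ y → y Fin.≤ t → ∃[ b ] ((X y , b) ∈ᵖ Λ y × X y + b ≡ D)
      go y (acc rs) i≤y y≤t
        with crosses (Λ y) D (subst (_≤ D) (sym (source-sum (π ⟨$⟩ˡ y))) n≤D) (D≤ y i≤y y≤t)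
      ... | x , b , ∈Λ , eq
        with X-surjective i≤y y≤t
               (east-of-t eq (≤-trans (proj₂ (∈⇒≤end ∈Λ)) (dom C t (proj₁ sm) y y≤t)))
               (proj₁ (∈⇒≤end ∈Λ))
      ... | z , y≤z , z≤t , refl with m≤n⇒m<n∨m≡n y≤z
      ... | inj₂ y≡z with refl ← Fin.toℕ-injective y≡z = b , ∈Λ , eq
      ... | inj₁ y<z with go z (rs y<z) (≤-trans i≤y y≤z) z≤t
      ... | b′ , ∈Λ′ , eq′ =
        contradiction eq′ (same-point (λ y≡z → <⇒≢ y<z (cong toℕ y≡z)) refl ∈Λ eq ∈Λ′)

    -- Domination keeps the path to j no deeper than β_t, so it meets `D` in a column from X t on;
    -- the columns from there up to X i are taken by `filled`.
    no-further-path : ∀ {j x b} → j Fin.< i → (x , b) ∈ᵖ Λ j → x + b ≡ D → ¬ (x < X i)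
    no-further-path {j} {x} j<i ∈Λ eq x<Xi =
      let Xt≤x = east-of-t eq (≤-trans (proj₂ (∈⇒≤end ∈Λ))
                                       (dom C t (proj₁ sm) j (≤-trans (<⇒≤ j<i) i≤t)))
          (z , i≤z , z≤t , Xz≡x) = X-surjective {x} {i} ≤-refl i≤t Xt≤x (<⇒≤ x<Xi)
          (_ , ∈Λ′ , eq′) = filled z i≤z z≤t
      in same-point (λ j≡z → <⇒≢ (<-≤-trans j<i i≤z) (cong toℕ j≡z)) (sym Xz≡x) ∈Λ eq ∈Λ′ eq′

    -- With the sources in this order, the path to j starts west of the path to i and ends east of
    -- it, so `stays-west` puts it west of X i on `D`.
    no-inversion : ∀ j → j Fin.< i → ¬ ((π ⟨$⟩ˡ i) Fin.< (π ⟨$⟩ˡ j))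
    no-inversion j j<i inv =
      let (x , b , ∈Λ , eq , x<Xi) =
            stays-west (Λ i) (Λ j) (trans (source-sum (π ⟨$⟩ˡ i)) (sym (source-sum (π ⟨$⟩ˡ j))))
             (∸-monoʳ-< (s≤s inv) (Fin.toℕ<n (π ⟨$⟩ˡ j)))
             (column-anti lam j<i)
             (Λ-disjoint (λ i≡j → <⇒≢ j<i (cong toℕ (sym i≡j))))
             D (subst (_≤ D) (sym (source-sum (π ⟨$⟩ˡ i))) n≤D) (D≤ i ≤-refl i≤t)
      in no-further-path j<i ∈Λ eq x<Xi

  π≈id : π ≈ id
  π≈id = increasing⇒identity π mono
    where
    mono : ∀ {l m} → l Fin.< m → (π ⟨$⟩ʳ l) Fin.< (π ⟨$⟩ʳ m)
    mono {l} {m} l<m with Fin.<-cmp (π ⟨$⟩ʳ l) (π ⟨$⟩ʳ m)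
    ... | tri< lt _ _ = lt
    ... | tri≈ _ eq _ = contradiction (cong toℕ (trans (sym (inverseˡ π)) (trans (cong (π ⟨$⟩ˡ_) eq) (inverseˡ π)))) (<⇒≢ l<m)
    -- For an inversion, i is π l, j is π m, and t is the first critical index from i on.
    ... | tri> _ _ gt = case platform-spec lam β (π ⟨$⟩ʳ l) of λ where
      (C , t , i∈C , sm , _) → contradiction
        (subst₂ Fin._<_ (sym (inverseˡ π)) (sym (inverseˡ π)) l<m)
        (no-inversion C i∈C sm (π ⟨$⟩ʳ m) gt)

dominates⇒nonpermutable : ∀ {n} (lam : Partition n) (β : Tuple n) → Upper β →
  CriticalDominates lam β → Nonpermutable lam β
dominates⇒nonpermutable lam β upper dom π π≉id ld = π≉id (Rigidity.π≈id lam β upper dom π ld)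

-- Staircase paths

-- `_≤‴_` is built by raising the lower bound, which matches adding steps at the front of a path.
eastward : ∀ {a a′ b} → a ≤‴ a′ → Path (a , b) (a′ , b)
eastward (≤‴-reflexive refl) = ε
eastward (≤‴-step p)         = easterly ◅ eastward p

southward : ∀ {a b b′} → b ≤‴ b′ → Path (a , b) (a , b′)
southward (≤‴-reflexive refl) = ε
southward (≤‴-step p)         = southerly ◅ southward p

∈-eastward : ∀ {a a′ b x y} (p : a ≤‴ a′) → (x , y) ∈ᵖ eastward {b = b} p →
  a ≤ x × x ≤ a′ × y ≡ b
∈-eastward (≤‴-reflexive refl) here      = ≤-refl , ≤-refl , refl
∈-eastward (≤‴-step p)         here      = ≤-refl , <⇒≤ (≤‴⇒≤ p) , refl
∈-eastward (≤‴-step p)         (there i) =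
  let (lo , hi , eq) = ∈-eastward p i in <⇒≤ lo , hi , eq

∈-southward : ∀ {a b b′ x y} (p : b ≤‴ b′) → (x , y) ∈ᵖ southward {a = a} p →
  b ≤ y × y ≤ b′ × x ≡ a
∈-southward (≤‴-reflexive refl) here      = ≤-refl , ≤-refl , refl
∈-southward (≤‴-step p)         here      = ≤-refl , <⇒≤ (≤‴⇒≤ p) , refl
∈-southward (≤‴-step p)         (there i) =
  let (lo , hi , eq) = ∈-southward p i in <⇒≤ lo , hi , eq

∈-◅◅ : ∀ {p s t u} (π : Path s t) {ρ : Path t u} → p ∈ᵖ (π ◅◅ ρ) → p ∈ᵖ π ⊎ p ∈ᵖ ρ
∈-◅◅ ε       i         = inj₂ i
∈-◅◅ (e ◅ π) here      = inj₁ here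
∈-◅◅ (e ◅ π) (there i) with ∈-◅◅ π i
... | inj₁ j = inj₁ (there j)
... | inj₂ j = inj₂ j

-- The staircase from (a , b) to (e , f) through the corner (c , d) runs east to
-- column c, south to row d, east to column e and south to row f.
record Corner (a b e f : ℕ) : Set where
  constructor corner
  field
    {c d} : ℕ
    a≤c   : a ≤ c
    c≤e   : c ≤ e
    b≤d   : b ≤ d
    d≤f   : d ≤ f

module _ {a b e f : ℕ} (K : Corner a b e f) where

  open Corner K

  staircase : Path (a , b) (e , f)
  staircase = eastward (≤⇒≤‴ a≤c) ◅◅ southward (≤⇒≤‴ b≤d)
           ◅◅ eastward (≤⇒≤‴ c≤e) ◅◅ southward (≤⇒≤‴ d≤f)

  -- Inequalities valid on all four legs at once, so that disjointness needs no case split over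
  -- pairs of legs.
  record InStaircase (x y : ℕ) : Set where
    field
      row≥b : b ≤ y
      row≤f : y ≤ f
      col≤e : x ≤ e
      leg₁  : y ≡ b ⊎ c ≤ x
      leg₂  : x ≤ c ⊎ d ≤ y
      leg₃  : y ≤ d ⊎ e ≤ x

  ∈-staircase : ∀ {x y} → (x , y) ∈ᵖ staircase → InStaircase x y
  ∈-staircase i with ∈-◅◅ (eastward (≤⇒≤‴ a≤c)) i
  ... | inj₁ j with ∈-eastward (≤⇒≤‴ a≤c) j
  ... | _ , x≤c , refl = record
    { row≥b = ≤-refl ; row≤f = ≤-trans b≤d d≤f ; col≤e = ≤-trans x≤c c≤e
    ; leg₁ = inj₁ refl ; leg₂ = inj₁ x≤c ; leg₃ = inj₁ b≤d }
  ∈-staircase i | inj₂ i₂ with ∈-◅◅ (southward (≤⇒≤‴ b≤d)) i₂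
  ... | inj₁ j with ∈-southward (≤⇒≤‴ b≤d) j
  ... | b≤y , y≤d , refl = record
    { row≥b = b≤y ; row≤f = ≤-trans y≤d d≤f ; col≤e = c≤e
    ; leg₁ = inj₂ ≤-refl ; leg₂ = inj₁ ≤-refl ; leg₃ = inj₁ y≤d }
  ∈-staircase i | inj₂ i₂ | inj₂ i₃ with ∈-◅◅ (eastward (≤⇒≤‴ c≤e)) i₃
  ... | inj₁ j with ∈-eastward (≤⇒≤‴ c≤e) j
  ... | c≤x , x≤e , refl = record
    { row≥b = b≤d ; row≤f = d≤f ; col≤e = x≤e
    ; leg₁ = inj₂ c≤x ; leg₂ = inj₂ ≤-refl ; leg₃ = inj₁ ≤-refl }
  ∈-staircase i | inj₂ i₂ | inj₂ i₃ | inj₂ j with ∈-southward (≤⇒≤‴ d≤f) j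
  ... | d≤y , y≤f , refl = record
    { row≥b = ≤-trans b≤d d≤y ; row≤f = y≤f ; col≤e = ≤-refl
    ; leg₁ = inj₂ c≤e ; leg₂ = inj₂ d≤y ; leg₃ = inj₂ ≤-refl }

module _ {a b e f a′ b′ e′ f′ : ℕ} (K : Corner a b e f) (K′ : Corner a′ b′ e′ f′) where

  open Corner K
  open Corner K′ using () renaming (c to c′; d to d′)

  -- Three ways for `K` to pass north-east of `K′`: `K′` ends west of the first turn of `K`; or it
  -- turns south earlier, and either its second turn is below all of `K`, or the two staircases are
  -- nested.
  Separated : Set
  Separated = e′ < c ⊎ (c′ < c × (f < d′ ⊎ (e′ < e × d < d′)))

  -- A common point lies below the first row of `K`, hence from column c on; if `K′` turns south
  -- before c, the point is also at row d′ or deeper. Each alternative then excludes it.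
  staircases-disjoint : b < b′ → Separated → Disjoint (staircase K) (staircase K′)
  staircases-disjoint b<b′ sep (x , y) (i , i′) = apart sep
    where
    open InStaircase (∈-staircase K i)
    open InStaircase (∈-staircase K′ i′) using ()
      renaming (row≥b to row≥b′; col≤e to col≤e′; leg₂ to leg₂′)
    c≤x : c ≤ x
    c≤x with leg₁
    ... | inj₁ refl = contradiction row≥b′ (<⇒≱ b<b′)
    ... | inj₂ c≤x  = c≤x
    d′≤y : c′ < c → d′ ≤ y
    d′≤y c′<c with leg₂′
    ... | inj₁ x≤c′ = contradiction (≤-trans c≤x x≤c′) (<⇒≱ c′<c)
    ... | inj₂ d′≤y = d′≤y
    apart : ¬ Separated
    apart (inj₁ e′<c) = <⇒≱ e′<c (≤-trans c≤x col≤e′)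
    apart (inj₂ (c′<c , inj₁ f<d′)) = <⇒≱ f<d′ (≤-trans (d′≤y c′<c) row≤f)
    apart (inj₂ (c′<c , inj₂ (e′<e , d<d′))) with leg₃
    ... | inj₁ y≤d = <⇒≱ d<d′ (≤-trans (d′≤y c′<c) y≤d)
    ... | inj₂ e≤x = <⇒≱ e′<e (≤-trans e≤x col≤e′)


-- The cycle sending t to i

punchIn-view : ∀ {n} (i : Fin (suc n)) k →
  (toℕ k < toℕ i × toℕ (punchIn i k) ≡ toℕ k) ⊎ (toℕ i ≤ toℕ k × toℕ (punchIn i k) ≡ suc (toℕ k))
punchIn-view zero    k       = inj₂ (z≤n , refl)
punchIn-view (suc i) zero    = inj₁ (z<s , refl)
punchIn-view (suc i) (suc k) with punchIn-view i k
... | inj₁ (k<i , eq) = inj₁ (s<s k<i , cong suc eq)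
... | inj₂ (i≤k , eq) = inj₂ (s≤s i≤k , cong suc eq)

module Cycle {n} {i t : Fin (suc n)} (i<t : i Fin.< t) where

  -- t ↦ i, i ↦ i + 1, …, t - 1 ↦ t, and all other indices are fixed.
  cycle : Permutation′ (suc n)
  cycle = insert t i id

  data View (m : Fin (suc n)) : Set where
    below   : m Fin.< i → cycle ⟨$⟩ʳ m ≡ m → View m
    shifted : i Fin.≤ m → m Fin.< t → toℕ (cycle ⟨$⟩ʳ m) ≡ suc (toℕ m) → View m
    top     : m ≡ t → cycle ⟨$⟩ʳ m ≡ i → View m
    above   : t Fin.< m → cycle ⟨$⟩ʳ m ≡ m → View m

  cycle-top : cycle ⟨$⟩ʳ t ≡ i
  cycle-top with t Fin.≟ t
  ... | yes _  = refl
  ... | no t≢t = contradiction refl t≢t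

  -- Away from t the cycle is `punchIn t k` ↦ `punchIn i k`, so the case depends on how k compares
  -- with t and i.
  view : ∀ m → View m
  view m with t Fin.≟ m
  ... | yes refl = top refl cycle-top
  ... | no t≢m = go (punchIn-view t k) (punchIn-view i k)
    where
    k : Fin n
    k = punchOut t≢m
    tk≡m : punchIn t k ≡ m
    tk≡m = Fin.punchIn-punchOut t≢m
    cycle-m : cycle ⟨$⟩ʳ m ≡ punchIn i k
    cycle-m = subst (λ z → cycle ⟨$⟩ʳ z ≡ punchIn i k) tk≡m (insert-punchIn t i id k)
    go : (toℕ k < toℕ t × toℕ (punchIn t k) ≡ toℕ k) ⊎ (toℕ t ≤ toℕ k × toℕ (punchIn t k) ≡ suc (toℕ k)) →
         (toℕ k < toℕ i × toℕ (punchIn i k) ≡ toℕ k) ⊎ (toℕ i ≤ toℕ k × toℕ (punchIn i k) ≡ suc (toℕ k)) →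
         View m
    go (inj₁ (k<t , eq)) v = low v
      where
      m≡k : toℕ m ≡ toℕ k
      m≡k = trans (cong toℕ (sym tk≡m)) eq
      low : _ → View m
      low (inj₁ (k<i , eq′)) = below (subst (_< toℕ i) (sym m≡k) k<i)
        (Fin.toℕ-injective (trans (cong toℕ cycle-m) (trans eq′ (sym m≡k))))
      low (inj₂ (i≤k , eq′)) = shifted (subst (toℕ i ≤_) (sym m≡k) i≤k) (subst (_< toℕ t) (sym m≡k) k<t)
        (trans (cong toℕ cycle-m) (trans eq′ (cong suc (sym m≡k))))
    go (inj₂ (t≤k , eq)) (inj₁ (k<i , _)) = contradiction (≤-trans (<⇒≤ i<t) t≤k) (<⇒≱ k<i)
    go (inj₂ (t≤k , eq)) (inj₂ (_ , eq′)) = above (subst (toℕ t <_) (sym m≡1+k) (s≤s t≤k))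
      (Fin.toℕ-injective (trans (cong toℕ cycle-m) (trans eq′ (sym m≡1+k))))
      where
      m≡1+k : toℕ m ≡ suc (toℕ k)
      m≡1+k = trans (cong toℕ (sym tk≡m)) eq

  cycle≉id : ¬ (cycle ≈ id)
  cycle≉id eq = <⇒≢ i<t (cong toℕ (trans (sym cycle-top) (eq t)))

  t<⇒fixed : ∀ {m} → t Fin.< m → cycle ⟨$⟩ʳ m ≡ m
  t<⇒fixed {m} t<m with view m
  ... | below m<i _     = contradiction (<-trans m<i i<t) (<⇒≯ t<m)
  ... | shifted _ m<t _ = contradiction m<t (<⇒≯ t<m)
  ... | top refl _      = contradiction t<m (n≮n _)
  ... | above _ eq      = eq

  <t⇒≥ : ∀ {m} → m Fin.< t → m Fin.≤ (cycle ⟨$⟩ʳ m)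
  <t⇒≥ {m} m<t with view m
  ... | below _ eq     = ≤-reflexive (cong toℕ (sym eq))
  ... | shifted _ _ eq = ≤-trans (n≤1+n _) (≤-reflexive (sym eq))
  ... | top refl _     = contradiction m<t (n≮n _)
  ... | above t<m _    = contradiction m<t (<⇒≯ t<m)

  <t⇒≤t : ∀ {m} → m Fin.< t → (cycle ⟨$⟩ʳ m) Fin.≤ t
  <t⇒≤t {m} m<t with view m
  ... | below _ eq     = ≤-trans (≤-reflexive (cong toℕ eq)) (<⇒≤ m<t)
  ... | shifted _ _ eq = ≤-trans (≤-reflexive eq) m<t
  ... | top refl _     = contradiction m<t (n≮n _)
  ... | above t<m _    = contradiction m<t (<⇒≯ t<m)

  <t⇒≤1+ : ∀ {m} → m Fin.< t → toℕ (cycle ⟨$⟩ʳ m) ≤ suc (toℕ m)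
  <t⇒≤1+ {m} m<t with view m
  ... | below _ eq     = ≤-trans (≤-reflexive (cong toℕ eq)) (n≤1+n _)
  ... | shifted _ _ eq = ≤-reflexive eq
  ... | top refl _     = contradiction m<t (n≮n _)
  ... | above t<m _    = contradiction m<t (<⇒≯ t<m)

  <t⇒<i∨i< : ∀ {m} → m Fin.< t → (cycle ⟨$⟩ʳ m) Fin.< i ⊎ i Fin.< (cycle ⟨$⟩ʳ m)
  <t⇒<i∨i< {m} m<t with view m
  ... | below m<i eq     = inj₁ (≤-<-trans (≤-reflexive (cong toℕ eq)) m<i)
  ... | shifted i≤m _ eq = inj₂ (≤-trans (s≤s i≤m) (≤-reflexive (sym eq)))
  ... | top refl _       = contradiction m<t (n≮n _)
  ... | above t<m _      = contradiction m<t (<⇒≯ t<m)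

  <t⇒mono : ∀ {l m} → l Fin.< m → m Fin.< t → (cycle ⟨$⟩ʳ l) Fin.< (cycle ⟨$⟩ʳ m)
  <t⇒mono {l} {m} l<m m<t with view m
  ... | top refl _       = contradiction m<t (n≮n _)
  ... | above t<m _      = contradiction m<t (<⇒≯ t<m)
  ... | shifted _ _ eq   = ≤-<-trans (<t⇒≤1+ (<-trans l<m m<t)) (≤-trans (s≤s l<m) (≤-reflexive (sym eq)))
  ... | below m<i eq with view l
  ...   | below _ eq′     = subst₂ Fin._<_ (sym eq′) (sym eq) l<m
  ...   | shifted i≤l _ _ = contradiction (≤-trans i≤l (<⇒≤ l<m)) (<⇒≱ m<i)
  ...   | top refl _      = contradiction (<-trans l<m m<t) (n≮n _)
  ...   | above t<l _     = contradiction (<-trans l<m m<t) (<⇒≯ t<l)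

-- Disjoint staircases from a violation of domination

module Violation {n} (lam : Partition (suc n)) (β : Tuple (suc n)) (upper : Upper β)
  {i t : Fin (suc n)} (i<t : i Fin.< t) (βt<βi : β at t < β at i)
  (between : ∀ y → i Fin.< y → y Fin.≤ t → β at y ≤ β at t)
  (part>0 : 0 < part lam t)
  (steep : ∀ m → t Fin.< m → part lam t ≤ part lam m → label m + β at t < β at m + label t) where

  open Cycle i<t

  X : Fin (suc n) → ℕ
  X = column lam

  π : Fin (suc n) → Fin (suc n)
  π m = cycle ⟨$⟩ʳ m

  -- As parts decrease, the inequality in `mid` singles out t and the later indices with the same
  -- part.
  data Zone (m : Fin (suc n)) : Set where
    low  : m Fin.< t → Zone m
    mid  : t Fin.≤ m → part lam t ≤ part lam m → Zone m
    high : t Fin.< m → part lam m < part lam t → Zone m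

  zone : ∀ m → Zone m
  zone m with m Fin.<? t | part lam t ≤? part lam m
  ... | yes m<t | _      = low m<t
  ... | no  m≮t | yes le = mid (≮⇒≥ m≮t) le
  ... | no  m≮t | no  ≰  = high (≤∧≢⇒< (≮⇒≥ m≮t) (λ eq → ≰ (≤-reflexive (cong (part lam) (Fin.toℕ-injective eq))))) (≰⇒> ≰)

  -- Paths in `low` and `high` run east and then straight down to their terminals. Those in `mid`
  -- turn south one column early and pass below row β_t; the offset m - t nests them.
  bend-col bend-row : ∀ {m} → Zone m → ℕ
  bend-col {m} (low _)    = X (π m)
  bend-col {m} (mid _ _)  = pred (X m)
  bend-col {m} (high _ _) = X (π m)
  bend-row {m} (low _)    = β at π m
  bend-row {m} (mid _ _)  = suc (β at t) + (label m ∸ label t)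
  bend-row {m} (high _ _) = β at π m

  X>0 : ∀ {m} → part lam t ≤ part lam m → 0 < X m
  X>0 {m} le = <-≤-trans part>0 (≤-trans le (m≤m+n (part lam m) _))

  -- pred (X m) is used only where X m is positive.
  predX< : ∀ {m} → part lam t ≤ part lam m → pred (X m) < X m
  predX< le = ≤-reflexive (suc-pred _ ⦃ >-nonZero (X>0 le) ⦄)

  π-high : ∀ {m} → t Fin.≤ m → X m ≤ X (π m)
  π-high {m} t≤m with m≤n⇒m<n∨m≡n t≤m
  ... | inj₁ t<m = ≤-reflexive (cong X (sym (t<⇒fixed t<m)))
  ... | inj₂ eq with refl ← Fin.toℕ-injective eq =
    subst (λ z → X t ≤ X z) (sym cycle-top) (column-anti-≤ lam (<⇒≤ i<t))

  source≤bend : ∀ {m} (z : Zone m) → suc n ∸ label m ≤ bend-col z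
  -- π m may be m + 1, which costs one column; the positive part of π m makes up for it.
  source≤bend {m} (low m<t) = +-cancelʳ-≤ (label (π m)) _ _ (begin
      suc n ∸ label m + label (π m)      ≤⟨ +-monoʳ-≤ (suc n ∸ label m) (s≤s (<t⇒≤1+ m<t)) ⟩
      suc n ∸ label m + suc (label m)    ≡⟨ +-suc _ (label m) ⟩
      suc (suc n ∸ label m + label m)    ≡⟨ cong suc (source-sum m) ⟩
      1 + suc n                          ≤⟨ +-monoˡ-≤ (suc n) (<-≤-trans part>0 (decreasing lam (π m) t (<t⇒≤t m<t))) ⟩
      part lam (π m) + suc n             ≡⟨ column+label lam (π m) ⟨
      X (π m) + label (π m)              ∎)
    where open ≤-Reasoning
  source≤bend {m} (mid _ le) = <⇒≤pred (+-monoˡ-≤ (suc n ∸ label m) (<-≤-trans part>0 le))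
  source≤bend {m} (high t<m _) = subst (λ z → suc n ∸ label m ≤ X z) (sym (t<⇒fixed t<m)) (m≤n+m _ (part lam m))

  bend≤end : ∀ {m} (z : Zone m) → bend-col z ≤ X (π m)
  bend≤end (low _)      = ≤-refl
  bend≤end (mid t≤m le) = ≤-trans pred[n]≤n (π-high t≤m)
  bend≤end (high _ _)   = ≤-refl

  source≤bend-row : ∀ {m} (z : Zone m) → label m ≤ bend-row z
  source≤bend-row {m} (low m<t) = ≤-trans (s≤s (<t⇒≥ m<t)) (upper (π m))
  source≤bend-row {m} (mid t≤m _) = begin
      label m                               ≡⟨ m+[n∸m]≡n (s≤s t≤m) ⟨
      label t + (label m ∸ label t)         ≤⟨ +-monoˡ-≤ _ (m≤n⇒m≤1+n (upper t)) ⟩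
      suc (β at t) + (label m ∸ label t)    ∎
    where open ≤-Reasoning
  source≤bend-row {m} (high t<m _) = subst (λ z → label m ≤ β at z) (sym (t<⇒fixed t<m)) (upper m)

  -- For m > t in `mid` this is the steepness at m, and for m = t it is β_t < β_i.
  bend≤end-row : ∀ {m} (z : Zone m) → bend-row z ≤ β at π m
  bend≤end-row (low _)    = ≤-refl
  bend≤end-row (high _ _) = ≤-refl
  bend≤end-row {m} (mid t≤m le) with m≤n⇒m<n∨m≡n t≤m
  ... | inj₁ t<m = subst (λ z → suc (β at t) + (label m ∸ label t) ≤ β at z) (sym (t<⇒fixed t<m))
    (+-cancelʳ-≤ (label t) _ _ (begin
      suc (β at t) + (label m ∸ label t) + label t    ≡⟨ +-assoc (suc (β at t)) _ (label t) ⟩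
      suc (β at t) + (label m ∸ label t + label t)    ≡⟨ cong (suc (β at t) +_) (m∸n+n≡m (s≤s t≤m)) ⟩
      suc (β at t) + label m                          ≡⟨ cong suc (+-comm (β at t) (label m)) ⟩
      suc (label m + β at t)                          ≤⟨ steep m t<m le ⟩
      β at m + label t                                ∎))
    where open ≤-Reasoning
  ... | inj₂ eq with refl ← Fin.toℕ-injective eq = subst (λ z → suc (β at t) + (label t ∸ label t) ≤ β at z) (sym cycle-top)
    (≤-trans (≤-reflexive (trans (cong (suc (β at t) +_) (n∸n≡0 (label t))) (+-identityʳ _))) βt<βi)

  bend : ∀ {m} → Zone m → Corner (suc n ∸ label m) (label m) (X (π m)) (β at π m)
  bend z = corner (source≤bend z) (bend≤end z) (source≤bend-row z) (bend≤end-row z)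

  separated : ∀ {l m} → l Fin.< m → (z : Zone l) (w : Zone m) → Separated (bend z) (bend w)
  separated l<m (low l<t) (low m<t) = inj₁ (column-anti lam (<t⇒mono l<m m<t))
  separated {l} {m} l<m (low l<t) (mid t≤m le) with m≤n⇒m<n∨m≡n t≤m
  ... | inj₁ t<m = inj₁ (subst (λ z → X z < X (π l)) (sym (t<⇒fixed t<m))
                          (column-anti lam (≤-<-trans (<t⇒≤t l<t) t<m)))
  ... | inj₂ eq with refl ← Fin.toℕ-injective eq with <t⇒<i∨i< l<t
  ...   | inj₁ πl<i = inj₁ (subst (λ z → X z < X (π l)) (sym cycle-top) (column-anti lam πl<i))
  -- The path to a terminal among i + 1, ..., t ends at depth at most β_t, above the row in which
  -- the path from source t runs east.
  ...   | inj₂ i<πl = inj₂ (<-≤-trans (predX< le) (column-anti-≤ lam (<t⇒≤t l<t)) ,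
                            inj₁ (≤-trans (s≤s (between (π l) i<πl (<t⇒≤t l<t))) (m≤m+n _ _)))
  separated {l} l<m (low l<t) (high t<m _) =
    inj₁ (subst (λ z → X z < X (π l)) (sym (t<⇒fixed t<m)) (column-anti lam (≤-<-trans (<t⇒≤t l<t) t<m)))
  separated {l} {m} l<m (mid t≤l le) (low m<t) = contradiction (≤-trans t≤l (<⇒≤ l<m)) (<⇒≱ m<t)
  -- Nested staircases: the later path turns south further west, turns east again deeper, and ends
  -- further west.
  separated {l} {m} l<m (mid t≤l le) (mid t≤m le′) = inj₂
    ( pred-mono-< ⦃ >-nonZero (X>0 le′) ⦄ (column-anti lam l<m)
    , inj₂ ( subst (λ z → X z < X (π l)) (sym (t<⇒fixed (≤-<-trans t≤l l<m))) (<-≤-trans (column-anti lam l<m) (π-high t≤l))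
           , +-monoʳ-< (suc (β at t)) (∸-monoˡ-< (s≤s l<m) (s≤s t≤l))))
  -- Smaller part and larger index together put X m at least two columns west of X l, so also west
  -- of the early turn.
  separated {l} {m} l<m (mid t≤l le) (high t<m lt) =
    inj₁ (subst (λ z → X z < pred (X l)) (sym (t<⇒fixed t<m))
      (<⇒≤pred (+-mono-≤-< (<-≤-trans lt le) (∸-monoʳ-< (s≤s l<m) (Fin.toℕ<n m)))))
  separated {l} {m} l<m (high t<l lt) (low m<t) = contradiction (<-trans t<l l<m) (<⇒≯ m<t)
  separated {l} {m} l<m (high t<l lt) (mid t≤m le) =
    contradiction (≤-trans le (decreasing lam l m (<⇒≤ l<m))) (<⇒≱ lt)
  separated {l} {m} l<m (high t<l _) (high t<m _) =
    inj₁ (subst₂ (λ y z → X z < X y) (sym (t<⇒fixed t<l)) (sym (t<⇒fixed t<m)) (column-anti lam l<m))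

  Λ : ∀ m → Path (source m) (terminal lam β (π m))
  Λ m = staircase (bend (zone m))

  Λ-disjoint-< : ∀ {l m} → l Fin.< m → Disjoint (Λ l) (Λ m)
  Λ-disjoint-< {l} {m} l<m = staircases-disjoint (bend (zone l)) (bend (zone m)) (s≤s l<m) (separated l<m (zone l) (zone m))

  Λ-disjoint : ∀ l m → l ≢ m → Disjoint (Λ l) (Λ m)
  Λ-disjoint l m l≢m p (i , j) with Fin.<-cmp l m
  ... | tri< l<m _ _ = Λ-disjoint-< l<m p (i , j)
  ... | tri≈ _ eq _  = l≢m eq
  ... | tri> _ _ m<l = Λ-disjoint-< m<l p (j , i)

  permutable : ¬ Nonpermutable lam β
  permutable np = np cycle cycle≉id (Λ , Λ-disjoint)

-- From nonpermutability to domination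

-- In the last carrel only n is critical: steepness at n for t < n would give n - t < β_n - β_t,
-- while β_n ≤ n and β_t ≥ t. Upperness makes β_n maximal.
last-carrel-dominates : ∀ {n} {lam : Partition n} (β : Tuple n) → Upper β →
  ∀ (C : Carrel lam) t → Critical β C t → right C ≡ n → ∀ j → β at j ≤ β at t
last-carrel-dominates {n} β upper C t ct r≡n j with label t <? right C
... | no  t≮r = ≤-trans (Fin.toℕ<n (β j)) (≤-trans (≤-reflexive (sym r≡n)) (≤-trans (≮⇒≥ t≮r) (upper t)))
... | yes t<r = contradiction
  (critical-steep β C ct x (subst (label t <_) (sym x≡r) t<r) (≤-reflexive x≡r))
  (≤⇒≯ (+-mono-≤ (≤-trans (Fin.toℕ<n (β x)) (≤-reflexive (sym (trans x≡r r≡n)))) (upper t)))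
  where
  x : Fin n
  x = proj₁ (last β C)
  x≡r : label x ≡ right C
  x≡r = proj₂ (last β C)

nonpermutable⇒dominates : ∀ {n} (lam : Partition n) (β : Tuple n) → Upper β →
  Nonpermutable lam β → CriticalDominates lam β
nonpermutable⇒dominates {zero}  lam β upper np C () ct j j≤t
nonpermutable⇒dominates {suc n} lam β upper np C t ct j j≤t with cut-right C
... | inj₁ r≡0        = contradiction (subst (left C <_) r≡0 (left<right C)) n≮0
... | inj₂ (inj₂ r≡n) = last-carrel-dominates β upper C t ct r≡n j
... | inj₂ (inj₁ (p , q , p≡r , q≡1+r , λq<λp)) = ≮⇒≥ λ βt<βj → violates
    (largest (λ z → (z Fin.<? t) ×-dec (β at t <? β at z))
      (j , ≤∧≢⇒< j≤t (λ eq → <⇒≢ βt<βj (cong (β at_) (Fin.toℕ-injective (sym eq)))) , βt<βj))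
  where
  λp≤λt : part lam p ≤ part lam t
  λp≤λt = decreasing lam t p (s≤s⁻¹ (subst (label t ≤_) (sym p≡r) (proj₂ (critical-∈ β C ct))))

  -- Past `right C` the parts are at most λ_q < λ_p ≤ λ_t.
  in-carrel : ∀ m → part lam t ≤ part lam m → label m ≤ right C
  in-carrel m λt≤λm = ≮⇒≥ λ r<m → <⇒≱ λq<λp (≤-trans λp≤λt (≤-trans λt≤λm
    (decreasing lam q m (s≤s⁻¹ (subst (_≤ label m) (sym q≡1+r) r<m)))))

  violates :
    ¬ (∃[ i ] ((i Fin.< t × β at t < β at i) × (∀ z → z Fin.< t × β at t < β at z → z Fin.≤ i)))
  -- Choosing the last violation i yields `between`, and the descent at `right C` makes λ_t
  -- positive.
  violates (i , (i<t , βt<βi) , last-violation) =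
    Violation.permutable lam β upper i<t βt<βi between
      (<-≤-trans (≤-<-trans z≤n λq<λp) λp≤λt)
      (λ m t<m λt≤λm → critical-steep β C ct m (s≤s t<m) (in-carrel m λt≤λm))
      np
    where
    between : ∀ y → i Fin.< y → y Fin.≤ t → β at y ≤ β at t
    between y i<y y≤t with m≤n⇒m<n∨m≡n y≤t
    ... | inj₁ y<t = ≮⇒≥ λ βt<βy → <⇒≱ i<y (last-violation y (y<t , βt<βy))
    ... | inj₂ eq  = ≤-reflexive (cong (β at_) (Fin.toℕ-injective eq))

theorem5p1 : (n : ℕ) → 1 ≤ n → (lam : Partition n) (β : Tuple n) → Upper β →
    Nonpermutable lam β ⇔ (UGC lam β × UBP lam β)
theorem5p1 n _ lam β upper = mk⇔
  (dominates⇒UGC∩UBP upper ∘ nonpermutable⇒dominates lam β upper)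
  (λ (ugc , ubp) → dominates⇒nonpermutable lam β upper (UGC∩UBP⇒dominates ugc ubp))
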